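{- Let $\mathbf{S}=(S,\eta^{S},\mu^{S})$ and $\mathbf{T}=(T,\eta^{T},\mu^{T})$ be monads on $\mathsf{Set}$, let $G:\mathsf{Set}\to\mathsf{Set}$ be a functor, let $\delta:TS\Rightarrow ST$ be a weak distributive law of monads and $\sigma:TG\Rightarrow GT$ a weak distributive law of the monad $\mathbf{T}$ over the functor $G$. Let $c:X\to GSTX$ be a $GST$-coalgebra and let $$c^{+}=GS\mu^{T}_{X}\circ G\delta_{TX}\circ\sigma_{STX}\circ Tc\;:\;TX\to GSTX .$$ Then: (1) the contextual closure $\mathsf{Ctx}_{\mu^{T}_{X}}$ is $\mathsf{Rel}(GS)_{c^{+}}$-compatible; (2) if $GS$ preserves weak pullbacks, then the congruence closure $\mathsf{Cgr}_{\mu^{T}_{X}}$ is $\mathsf{Rel}(GS)_{c^{+}}$-compatible.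
   Context: A weak distributive law of monads is a natural transformation $\delta:TS\Rightarrow ST$ with $\delta\circ\mu^{T}S = S\mu^{T}\circ\delta T\circ T\delta$, $\;\delta\circ T\mu^{S}=\mu^{S}T\circ S\delta\circ\delta S$, $\;\delta\circ T\eta^{S}=\eta^{S}T$ (compatibility with $\eta^{T}$ is not required). A weak distributive law of $\mathbf{T}$ over an endofunctor $G$ is a natural transformation $\sigma:TG\Rightarrow GT$ with $\sigma\circ\mu^{T}G=G\mu^{T}\circ\sigma T\circ T\sigma$. For a functor $F:\mathsf{Set}\to\mathsf{Set}$, an $F$-coalgebra $\xi:Y\to FY$ and a relation $R\subseteq Y\times Y$ with projections $\pi_1,\pi_2:R\to Y$, $$\mathsf{Rel}(F)_{\xi}(R)=\{(u,v)\in Y\times Y\mid \exists t\in FR,\ (\xi(u),\xi(v))=(F\pi_1(t),F\pi_2(t))\}.$$ A monotone function $\mathsf{Tch}$ on the lattice $\mathcal{P}(Y\times Y)$ of relations (ordered by inclusion) is $\mathsf{Rel}(F)_{\xi}$-compatible if $\mathsf{Tch}(\mathsf{Rel}(F)_{\xi}(R))\subseteq\mathsf{Rel}(F)_{\xi}(\mathsf{Tch}(R))$ for all $R\subseteq Y\times Y$. For a map $\alpha:TY\to Y$, the contextual closure is $\mathsf{Ctx}_{\alpha}(R)=\{(\alpha(T\pi_1(t)),\alpha(T\pi_2(t)))\mid t\in TR\}$, and the congruence closure is $$\mathsf{Cgr}_{\alpha}(R)=\bigcup_{n\ge 0}(\mathsf{Tra}\cup\mathsf{Sym}\cup\mathsf{Ctx}_{\alpha}\cup\mathsf{Rfl})^{n}(R),$$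 where unions of functions on relations are pointwise, powers are iterated composition, $\mathsf{Tra}(R)=\{(x,z)\mid\exists y,\ (x,y)\in R,\ (y,z)\in R\}$, $\mathsf{Sym}(R)=\{(y,x)\mid(x,y)\in R\}$, and $\mathsf{Rfl}(R)=\{(x,x)\mid x\in Y\}$. Here $Y=TX$ and $\alpha=\mu^{T}_{X}$. -}

module Defs where

open import Data.Nat.Base using (ℕ)
open import Data.Product.Base using (Σ-syntax; ∃-syntax; _×_; _,_; proj₁; proj₂)
open import Function.Base using (id; _∘_; flip)
import Function.Endo.Propositional as Endo
open import Level using (Level; suc)
open import Relation.Binary.Construct.Union using (_∪_)
open import Relation.Binary.Core using (Rel; _⇒_)
open import Relation.Binary.PropositionalEquality using (_≡_; _≗_; refl; trans)

private
  variable
    ℓ : Level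

-- The category of sets has the types in Set ℓ as objects and functions as
-- morphisms.  In the absence of function extensionality, equality of morphisms
-- is _≗_, so a functor must also be required to respect it (F-resp-≗).

record Functor (ℓ : Level) : Set (suc ℓ) where
  field
    F₀       : Set ℓ → Set ℓ
    F₁       : {A B : Set ℓ} → (A → B) → F₀ A → F₀ B
    F-resp-≗ : {A B : Set ℓ} {f g : A → B} → f ≗ g → F₁ f ≗ F₁ g
    F-id     : {A : Set ℓ} → F₁ (id {A = A}) ≗ id
    F-∘      : {A B C : Set ℓ} (g : B → C) (f : A → B) → F₁ (g ∘ f) ≗ F₁ g ∘ F₁ f

open Functor

Id : Functor ℓ
Id = record
  { F₀       = id
  ; F₁       = id
  ; F-resp-≗ = id
  ; F-id     = λ _ → refl
  ; F-∘      = λ _ _ _ → refl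
  }

infixr 9 _⊚_

_⊚_ : Functor ℓ → Functor ℓ → Functor ℓ
G ⊚ F = record
  { F₀       = F₀ G ∘ F₀ F
  ; F₁       = F₁ G ∘ F₁ F
  ; F-resp-≗ = F-resp-≗ G ∘ F-resp-≗ F
  ; F-id     = λ x → trans (F-resp-≗ G (F-id F) x) (F-id G x)
  ; F-∘      = λ g f x → trans (F-resp-≗ G (F-∘ F g f) x) (F-∘ G (F₁ F g) (F₁ F f) x)
  }

record NaturalTransformation (F G : Functor ℓ) : Set (suc ℓ) where
  field
    component : (X : Set ℓ) → F₀ F X → F₀ G X
    natural   : {X Y : Set ℓ} (f : X → Y) →
                component Y ∘ F₁ F f ≗ F₁ G f ∘ component X

open NaturalTransformation

record Monad (ℓ : Level) : Set (suc ℓ) where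
  field
    functor : Functor ℓ
    unit    : NaturalTransformation Id functor
    mult    : NaturalTransformation (functor ⊚ functor) functor

  open Functor functor public renaming (F₀ to M₀; F₁ to M₁)

  η : (X : Set ℓ) → X → M₀ X
  η = component unit

  μ : (X : Set ℓ) → M₀ (M₀ X) → M₀ X
  μ = component mult

  field
    identityˡ : (X : Set ℓ) → μ X ∘ η (M₀ X) ≗ id
    identityʳ : (X : Set ℓ) → μ X ∘ M₁ (η X) ≗ id
    assoc     : (X : Set ℓ) → μ X ∘ μ (M₀ X) ≗ μ X ∘ M₁ (μ X)

open Monad using (functor; M₀; M₁; η; μ)

record WeakDistributiveLawOverFunctor (T : Monad ℓ) (G : Functor ℓ) : Set (suc ℓ) where
  field
    law : NaturalTransformation (functor T ⊚ G) (G ⊚ functor T)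

  at : (X : Set ℓ) → M₀ T (F₀ G X) → F₀ G (M₀ T X)
  at = component law

  field
    mult-T : (X : Set ℓ) →
             at X ∘ μ T (F₀ G X) ≗ F₁ G (μ T X) ∘ at (M₀ T X) ∘ M₁ T (at X)

record WeakDistributiveLaw (T S : Monad ℓ) : Set (suc ℓ) where
  field
    overFunctor : WeakDistributiveLawOverFunctor T (functor S)

  open WeakDistributiveLawOverFunctor overFunctor public

  field
    mult-S : (X : Set ℓ) →
             at X ∘ M₁ T (μ S X) ≗ μ S (M₀ T X) ∘ M₁ S (at X) ∘ at (M₀ S X)
    unit-S : (X : Set ℓ) →
             at X ∘ M₁ T (η S X) ≗ η S (M₀ T X)

module _ (S T : Monad ℓ) (G : Functor ℓ)
         (δ : WeakDistributiveLaw T S) (σ : WeakDistributiveLawOverFunctor T G) where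

  private
    module δ = WeakDistributiveLaw δ
    module σ = WeakDistributiveLawOverFunctor σ

  determinisation : {X : Set ℓ} →
                    (X → F₀ G (M₀ S (M₀ T X))) → M₀ T X → F₀ G (M₀ S (M₀ T X))
  determinisation {X} c =
    F₁ G (M₁ S (μ T X)) ∘ F₁ G (δ.at (M₀ T X)) ∘ σ.at (M₀ S (M₀ T X)) ∘ M₁ T c

record IsWeakPullback {P A B C : Set ℓ}
                      (p : P → A) (q : P → B) (f : A → C) (g : B → C) : Set (suc ℓ) where
  field
    commutes : f ∘ p ≗ g ∘ q
    mediate  : {Q : Set ℓ} (a : Q → A) (b : Q → B) → f ∘ a ≗ g ∘ b →
               Σ[ h ∈ (Q → P) ] (p ∘ h ≗ a) × (q ∘ h ≗ b)

PreservesWeakPullbacks : Functor ℓ → Set (suc ℓ)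
PreservesWeakPullbacks {ℓ} F =
  {P A B C : Set ℓ} {p : P → A} {q : P → B} {f : A → C} {g : B → C} →
  IsWeakPullback p q f g → IsWeakPullback (F₁ F p) (F₁ F q) (F₁ F f) (F₁ F g)

-- A relation R ⊆ Y × Y is a type-valued predicate Rel Y ℓ, ordered by _⇒_.  It
-- may be proof-relevant: membership in the relations below carries its
-- witnesses, so a function can be read off a family of existence statements,
-- where on paper the axiom of choice would be used.

module _ {Y : Set ℓ} where

  Graph : Rel Y ℓ → Set ℓ
  Graph R = Σ[ (x , y) ∈ Y × Y ] R x y

  π₁ π₂ : {R : Rel Y ℓ} → Graph R → Y
  π₁ = proj₁ ∘ proj₁
  π₂ = proj₂ ∘ proj₁

  RelLift : (F : Functor ℓ) → (Y → F₀ F Y) → Rel Y ℓ → Rel Y ℓ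
  RelLift F ξ R u v =
    ∃[ t ] (ξ u , ξ v) ≡ (F₁ F (π₁ {R}) t , F₁ F (π₂ {R}) t)

  Monotone : (Rel Y ℓ → Rel Y ℓ) → Set (suc ℓ)
  Monotone Φ = {R R′ : Rel Y ℓ} → R ⇒ R′ → Φ R ⇒ Φ R′

  record IsCompatible (b Tch : Rel Y ℓ → Rel Y ℓ) : Set (suc ℓ) where
    field
      monotone   : Monotone Tch
      compatible : (R : Rel Y ℓ) → Tch (b R) ⇒ b (Tch R)

  Tra Sym Rfl : Rel Y ℓ → Rel Y ℓ
  Tra R x z = ∃[ y ] R x y × R y z
  Sym R = flip R
  Rfl R = _≡_

  module _ (T : Functor ℓ) (α : F₀ T Y → Y) where

    Ctx : Rel Y ℓ → Rel Y ℓ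
    Ctx R x y =
      ∃[ t ] (x , y) ≡ (α (F₁ T (π₁ {R}) t) , α (F₁ T (π₂ {R}) t))

    Cgr : Rel Y ℓ → Rel Y ℓ
    Cgr R x y = ∃[ n ] (step ^ n) R x y
      where
      open Endo (Rel Y ℓ) using (_^_)

      step : Rel Y ℓ → Rel Y ℓ
      step R = Tra R ∪ Sym R ∪ Ctx R ∪ Rfl R

{-# OPTIONS --safe #-}
module Submission where

-- The laws δ and σ compose to a law λ : TGS ⇒ GST compatible with μᵀ.  This
-- makes (μᵀ, c⁺) a λ-bialgebra, since c⁺ = GSμ ∘ λ ∘ T c.  In a bialgebra, a
-- T-term over pairs related by Rel(GS)(R) is pushed through λ to a GS-structure
-- of T-terms over R, which gives (1).  For (2), compatible functions are closed
-- under unions and iteration, and Tra is compatible because preservation of weak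
-- pullbacks glues two GS-structures over R along their common projection.

open import Defs
open import Data.Nat.Base using (zero; suc)
open import Data.Product.Base using (Σ-syntax; _×_; _,_; proj₁; proj₂; map₂)
open import Data.Sum.Base using (inj₁; inj₂; [_,_]) renaming (map to map-⊎)
open import Data.Unit.Polymorphic.Base using (⊤; tt)
open import Function.Base using (id; _∘_)
import Function.Endo.Propositional as Endo
open import Level using (Level)
open import Relation.Binary.Construct.Union using (_∪_)
open import Relation.Binary.Core using (Rel; _⇒_)
open import Relation.Binary.PropositionalEquality
  using (_≡_; _≗_; refl; sym; trans; subst; cong; cong₂; module ≡-Reasoning)

open Functor using (F₀; F₁; F-resp-≗; F-id; F-∘)
open NaturalTransformation using (component; natural)
open IsCompatible
open IsWeakPullback using (mediate)
open ≡-Reasoning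

private
  variable
    ℓ : Level
    Y : Set ℓ

-- Whiskering and the composite of two laws.

_∘ᴳ_ : (G : Functor ℓ) {F F′ : Functor ℓ} →
       NaturalTransformation F F′ → NaturalTransformation (G ⊚ F) (G ⊚ F′)
G ∘ᴳ θ = record
  { component = λ X → F₁ G (component θ X)
  ; natural   = λ {X} {Y} f x →
      trans (sym (F-∘ G (component θ Y) _ x))
     (trans (F-resp-≗ G (natural θ f) x) (F-∘ G _ (component θ X) x))
  }

module _ {T : Monad ℓ} {G H : Functor ℓ}
         (σ : WeakDistributiveLawOverFunctor T G)
         (δ : WeakDistributiveLawOverFunctor T H) where

  private
    module T = Monad T
    module σ = WeakDistributiveLawOverFunctor σ
    module δ = WeakDistributiveLawOverFunctor δ

  -- The composite is `G` applied to `δ`, after `σ` at `H`. For compatibility with multiplication,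
  -- the squares of `σ` and `δ` are pasted; naturality of `σ` at `δ.at X` then moves the inner `δ`
  -- under `T`, where it joins the inner `σ`.
  composeLaw : WeakDistributiveLawOverFunctor T (G ⊚ H)
  composeLaw = record
    { law = record
      { component = at
      ; natural   = λ {X} {Y} f x → begin
          F₁ G (δ.at Y) (σ.at (F₀ H Y) (T.M₁ (F₁ G (F₁ H f)) x))
            ≡⟨ cong (F₁ G (δ.at Y)) (natural σ.law (F₁ H f) x) ⟩
          F₁ G (δ.at Y) (F₁ G (T.M₁ (F₁ H f)) (σ.at (F₀ H X) x))
            ≡⟨ natural (G ∘ᴳ δ.law) f _ ⟩
          F₁ G (F₁ H (T.M₁ f)) (at X x) ∎
      }
    ; mult-T = λ X x → begin
        F₁ G (δ.at X) (σ.at (F₀ H X) (T.μ _ x))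
          ≡⟨ cong (F₁ G (δ.at X)) (σ.mult-T _ x) ⟩
        F₁ G (δ.at X) (F₁ G (T.μ _) (σ.at _ (T.M₁ (σ.at _) x)))
          ≡⟨ F-∘ G _ _ _ ⟨
        F₁ G (δ.at X ∘ T.μ _) (σ.at _ (T.M₁ (σ.at _) x))
          ≡⟨ F-resp-≗ G (δ.mult-T X) _ ⟩
        F₁ G (F₁ H (T.μ X) ∘ δ.at (T.M₀ X) ∘ T.M₁ (δ.at X)) (σ.at _ (T.M₁ (σ.at _) x))
          ≡⟨ trans (F-∘ G _ _ _) (cong (F₁ G (F₁ H (T.μ X))) (F-∘ G _ _ _)) ⟩
        F₁ G (F₁ H (T.μ X)) (F₁ G (δ.at (T.M₀ X)) (F₁ G (T.M₁ (δ.at X)) (σ.at _ (T.M₁ (σ.at _) x))))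
          ≡⟨ cong (F₁ G (F₁ H (T.μ X)) ∘ F₁ G (δ.at (T.M₀ X))) (natural σ.law (δ.at X) _) ⟨
        F₁ G (F₁ H (T.μ X)) (F₁ G (δ.at (T.M₀ X)) (σ.at _ (T.M₁ (F₁ G (δ.at X)) (T.M₁ (σ.at _) x))))
          ≡⟨ cong (F₁ G (F₁ H (T.μ X)) ∘ at (T.M₀ X)) (T.F-∘ _ _ x) ⟨
        F₁ G (F₁ H (T.μ X)) (at (T.M₀ X) (T.M₁ (at X) x)) ∎
    }
    where
    at : (X : Set ℓ) → T.M₀ (F₀ G (F₀ H X)) → F₀ G (F₀ H (T.M₀ X))
    at X = F₁ G (δ.at X) ∘ σ.at (F₀ H X)

-- Bialgebras: `ξ` as a homomorphism from `α` to `F₁ F α ∘ component θ Y`.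

IsBialgebra : (T F : Functor ℓ) → NaturalTransformation (T ⊚ F) (F ⊚ T) →
              {Y : Set ℓ} → (F₀ T Y → Y) → (Y → F₀ F Y) → Set ℓ
IsBialgebra T F θ {Y} α ξ = ξ ∘ α ≗ F₁ F α ∘ component θ Y ∘ F₁ T ξ

module _ {T : Monad ℓ} {F : Functor ℓ} (θ : WeakDistributiveLawOverFunctor T F) where

  private
    module T = Monad T
    module θ = WeakDistributiveLawOverFunctor θ

  -- `mult-T` splits `θ` at a flattened term into two nested copies; associativity and naturality of
  -- `θ` then regroup the result so that the extended coalgebra reappears under `T`.
  extension-isBialgebra : {X : Set ℓ} (c : X → F₀ F (T.M₀ X)) →
    IsBialgebra T.functor F θ.law (T.μ X) (F₁ F (T.μ X) ∘ θ.at (T.M₀ X) ∘ T.M₁ c)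
  extension-isBialgebra {X} c x = begin
    F₁ F μX (θ.at TX (T.M₁ c (T.μ X x)))
      ≡⟨ cong (F₁ F μX ∘ θ.at TX) (natural T.mult c x) ⟨
    F₁ F μX (θ.at TX (T.μ _ x₁))
      ≡⟨ cong (F₁ F μX) (θ.mult-T TX x₁) ⟩
    F₁ F μX (F₁ F (T.μ TX) (θ.at _ (T.M₁ (θ.at TX) x₁)))
      ≡⟨ F-∘ F _ _ _ ⟨
    F₁ F (μX ∘ T.μ TX) (θ.at _ (T.M₁ (θ.at TX) x₁))
      ≡⟨ F-resp-≗ F (T.assoc X) _ ⟩
    F₁ F (μX ∘ T.M₁ μX) (θ.at _ (T.M₁ (θ.at TX) x₁))
      ≡⟨ F-∘ F _ _ _ ⟩
    F₁ F μX (F₁ F (T.M₁ μX) (θ.at _ (T.M₁ (θ.at TX) x₁)))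
      ≡⟨ cong (F₁ F μX) (natural θ.law μX _) ⟨
    F₁ F μX (θ.at TX (T.M₁ (F₁ F μX) (T.M₁ (θ.at TX) x₁)))
      ≡⟨ cong (F₁ F μX ∘ θ.at TX ∘ T.M₁ (F₁ F μX)) (T.F-∘ _ _ x) ⟨
    F₁ F μX (θ.at TX (T.M₁ (F₁ F μX) (T.M₁ (θ.at TX ∘ T.M₁ c) x)))
      ≡⟨ cong (F₁ F μX ∘ θ.at TX) (T.F-∘ _ _ x) ⟨
    F₁ F μX (θ.at TX (T.M₁ (F₁ F μX ∘ θ.at TX ∘ T.M₁ c) x)) ∎
    where
    TX = T.M₀ X
    μX = T.μ X
    x₁ = T.M₁ (T.M₁ c) x

-- Monotonicity of the closure operators.

Graph-map : {R R′ : Rel Y ℓ} → R ⇒ R′ → Graph R → Graph R′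
Graph-map R⇒R′ = map₂ R⇒R′

Ctx-monotone : (T : Functor ℓ) (α : F₀ T Y → Y) → Monotone (Ctx T α)
Ctx-monotone T α R⇒R′ (t , refl) =
  F₁ T (Graph-map R⇒R′) t , cong₂ (λ x y → α x , α y) (F-∘ T _ _ t) (F-∘ T _ _ t)

Rfl-monotone : Monotone {Y = Y} Rfl
Rfl-monotone _ = id

Sym-monotone : Monotone {Y = Y} Sym
Sym-monotone R⇒R′ = R⇒R′

Tra-monotone : Monotone {Y = Y} Tra
Tra-monotone R⇒R′ (y , r , s) = y , R⇒R′ r , R⇒R′ s

pullback-isWeakPullback : {A B C : Set ℓ} (f : A → C) (g : B → C) →
  IsWeakPullback {P = Σ[ (a , b) ∈ A × B ] f a ≡ g b} (proj₁ ∘ proj₁) (proj₂ ∘ proj₁) f g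
pullback-isWeakPullback f g = record
  { commutes = proj₂
  ; mediate  = λ a b fa≗gb →
      (λ q → (a q , b q) , fa≗gb q) , (λ _ → refl) , (λ _ → refl)
  }

module _ {Y : Set ℓ} (F : Functor ℓ) (ξ : Y → F₀ F Y) where

  -- Pushing `t` forward along `f` gives the required structure over `Graph R`. Each compatibility
  -- proof can thus choose a convenient index type `A`.
  RelLift-intro : {A : Set ℓ} {R : Rel Y ℓ} (f : A → Graph R) {u v : Y} (t : F₀ F A) →
                  ξ u ≡ F₁ F (π₁ {R = R} ∘ f) t → ξ v ≡ F₁ F (π₂ {R = R} ∘ f) t →
                  RelLift F ξ R u v
  RelLift-intro f t p q =
    F₁ F f t , cong₂ _,_ (trans p (F-∘ F _ f t)) (trans q (F-∘ F _ f t))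

  RelLift-monotone : Monotone (RelLift F ξ)
  RelLift-monotone {R} {R′} R⇒R′ (t , eq) =
    RelLift-intro {R = R′} (Graph-map R⇒R′) t (cong proj₁ eq) (cong proj₂ eq)

  Rfl-compatible : IsCompatible (RelLift F ξ) Rfl
  Rfl-compatible = record
    { monotone   = λ {R} {R′} → Rfl-monotone {R = R} {R′}
    -- The structure `ξ x` itself is moved along the diagonal, on which both projections are the
    -- identity.
    ; compatible = λ { R {x} refl → RelLift-intro {R = _≡_} (λ y → (y , y) , refl) (ξ x)
                                      (sym (F-id F (ξ x))) (sym (F-id F (ξ x))) }
    }

  Sym-compatible : IsCompatible (RelLift F ξ) Sym
  Sym-compatible = record
    { monotone   = λ {R} {R′} → Sym-monotone {R = R} {R′}
    ; compatible = λ { R (t , eq) →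
        RelLift-intro {R = Sym R} (λ ((x , y) , r) → (y , x) , r) t
          (cong proj₂ eq) (cong proj₁ eq) }
    }

  Tra-compatible : PreservesWeakPullbacks F → IsCompatible (RelLift F ξ) Tra
  Tra-compatible preserves = record
    { monotone   = Tra-monotone
    ; compatible = compat
    }
    where
    compat : (R : Rel Y ℓ) → Tra (RelLift F ξ R) ⇒ RelLift F ξ (Tra R)
    compat R {x} {z} (y , (s , eq₁) , (t , eq₂)) =
      RelLift-intro {R = Tra R} glue (h tt)
        (trans (cong proj₁ eq₁)
          (trans (cong (F₁ F (π₁ {R = R})) (sym (left tt))) (sym (F-∘ F _ _ (h tt)))))
        (trans (cong proj₂ eq₂)
          (trans (cong (F₁ F (π₂ {R = R})) (sym (right tt))) (sym (F-∘ F _ _ (h tt)))))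
      where
      P : Set ℓ
      P = Σ[ (r , s) ∈ Graph R × Graph R ] π₂ {R = R} r ≡ π₁ {R = R} s

      glue : P → Graph (Tra R)
      glue ((((x , y) , r) , ((_ , z) , s)) , eq) =
        (x , z) , y , r , subst (λ y → R y z) (sym eq) s

      -- Both `F₁ F π₂ s` and `F₁ F π₁ t` equal `ξ y`, so the elements `s` and `t`, seen as maps out
      -- of a point, form a cone. Its mediating map picks an element of `F₀ F P` lying over both.
      mediating = mediate (preserves (pullback-isWeakPullback (π₂ {R = R}) (π₁ {R = R})))
                    {Q = ⊤} (λ _ → s) (λ _ → t)
                    (λ _ → trans (sym (cong proj₂ eq₁)) (cong proj₁ eq₂))
      h = proj₁ mediating
      left = proj₁ (proj₂ mediating)
      right = proj₂ (proj₂ mediating)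

  module _ {T : Functor ℓ} (θ : NaturalTransformation (T ⊚ F) (F ⊚ T))
           {α : F₀ T Y → Y} (bialgebra : IsBialgebra T F θ α ξ) where

    -- The bialgebra square followed by naturality of `θ` at `g`. The resulting structure
    -- `component θ B (F₁ T s t)` depends only on `s` and `t`, so the two projections of a relation
    -- can share it.
    bialgebra-lift : {A B : Set ℓ} (f : A → Y) (g : B → Y) (s : A → F₀ F B) →
                     ξ ∘ f ≗ F₁ F g ∘ s →
                     ξ ∘ α ∘ F₁ T f ≗ F₁ F (α ∘ F₁ T g) ∘ component θ B ∘ F₁ T s
    bialgebra-lift {A} {B} f g s square t = begin
      ξ (α (F₁ T f t))
        ≡⟨ bialgebra _ ⟩
      F₁ F α (component θ Y (F₁ T ξ (F₁ T f t)))
        ≡⟨ cong (F₁ F α ∘ component θ Y) (F-∘ T ξ f t) ⟨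
      F₁ F α (component θ Y (F₁ T (ξ ∘ f) t))
        ≡⟨ cong (F₁ F α ∘ component θ Y) (F-resp-≗ T square t) ⟩
      F₁ F α (component θ Y (F₁ T (F₁ F g ∘ s) t))
        ≡⟨ cong (F₁ F α ∘ component θ Y) (F-∘ T _ s t) ⟩
      F₁ F α (component θ Y (F₁ T (F₁ F g) (F₁ T s t)))
        ≡⟨ cong (F₁ F α) (natural θ g _) ⟩
      F₁ F α (F₁ F (F₁ T g) (component θ B (F₁ T s t)))
        ≡⟨ F-∘ F α _ _ ⟨
      F₁ F (α ∘ F₁ T g) (component θ B (F₁ T s t)) ∎

    Ctx-compatible : IsCompatible (RelLift F ξ) (Ctx T α)
    Ctx-compatible = record
      { monotone   = Ctx-monotone T α
      ; compatible = λ { R (t , refl) →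
          -- One structure of `T`-terms over `R` serves both sides; each such term `r` is sent to
          -- the pair of its two evaluations under `α`.
          RelLift-intro {R = Ctx T α R} (λ r → _ , r , refl) (component θ _ (F₁ T witness t))
            (bialgebra-lift _ (π₁ {R = R}) witness (λ (_ , _ , eq) → cong proj₁ eq) t)
            (bialgebra-lift _ (π₂ {R = R}) witness (λ (_ , _ , eq) → cong proj₂ eq) t) }
      }
      where
      witness : {R : Rel Y ℓ} → Graph (RelLift F ξ R) → F₀ F (Graph R)
      witness (_ , t , _) = t

-- Closure properties of compatible functions.

module _ {Y : Set ℓ} {b : Rel Y ℓ → Rel Y ℓ} (b-monotone : Monotone b) where

  open Endo (Rel Y ℓ) using (_^_)

  ∪-compatible : {Φ Ψ : Rel Y ℓ → Rel Y ℓ} → IsCompatible b Φ → IsCompatible b Ψ →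
                 IsCompatible b (λ R → Φ R ∪ Ψ R)
  ∪-compatible Φᶜ Ψᶜ = record
    { monotone   = λ R⇒R′ → map-⊎ (monotone Φᶜ R⇒R′) (monotone Ψᶜ R⇒R′)
    ; compatible = λ R → [ b-monotone inj₁ ∘ compatible Φᶜ R
                         , b-monotone inj₂ ∘ compatible Ψᶜ R ]
    }

  ^-compatible : {Φ : Rel Y ℓ → Rel Y ℓ} → IsCompatible b Φ → ∀ n → IsCompatible b (Φ ^ n)
  ^-compatible Φᶜ zero = record
    { monotone   = λ R⇒R′ → R⇒R′
    ; compatible = λ _ → id
    }
  ^-compatible Φᶜ (suc n) = record
    { monotone   = λ R⇒R′ → monotone Φᶜ (monotone Φⁿᶜ R⇒R′)
    -- Monotonicity of `Φ` applies the induction hypothesis underneath `Φ`; compatibility of `Φ`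
    -- then moves `b` outside.
    ; compatible = λ R → compatible Φᶜ _ ∘ monotone Φᶜ (compatible Φⁿᶜ R)
    }
    where Φⁿᶜ = ^-compatible Φᶜ n

  ⋃-compatible : {I : Set} {Φ : I → Rel Y ℓ → Rel Y ℓ} → (∀ i → IsCompatible b (Φ i)) →
                 IsCompatible b (λ R x y → Σ[ i ∈ I ] Φ i R x y)
  ⋃-compatible Φᶜ = record
    { monotone   = λ R⇒R′ (i , r) → i , monotone (Φᶜ i) R⇒R′ r
    ; compatible = λ R (i , r) → b-monotone (i ,_) (compatible (Φᶜ i) R r)
    }

  Cgr-compatible : (T : Functor ℓ) (α : F₀ T Y → Y) →
                   IsCompatible b Tra → IsCompatible b Sym →
                   IsCompatible b (Ctx T α) → IsCompatible b Rfl →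
                   IsCompatible b (Cgr T α)
  Cgr-compatible T α Traᶜ Symᶜ Ctxᶜ Rflᶜ =
    ⋃-compatible (^-compatible
      (∪-compatible Traᶜ (∪-compatible Symᶜ (∪-compatible Ctxᶜ Rflᶜ))))

theorem23 :
    {ℓ : Level} (S T : Monad ℓ) (G : Functor ℓ)
    (δ : WeakDistributiveLaw T S) (σ : WeakDistributiveLawOverFunctor T G)
    {X : Set ℓ} (c : X → Functor.F₀ G (Monad.M₀ S (Monad.M₀ T X))) →
    let GS = G ⊚ Monad.functor S
        c⁺ = determinisation S T G δ σ c
    in IsCompatible (RelLift GS c⁺) (Ctx (Monad.functor T) (Monad.μ T X))
       × (PreservesWeakPullbacks GS →
          IsCompatible (RelLift GS c⁺) (Cgr (Monad.functor T) (Monad.μ T X)))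
theorem23 S T G δ σ c =
  Ctxᶜ , λ preserves →
    Cgr-compatible (RelLift-monotone GS c⁺) (Monad.functor T) (Monad.μ T _)
      (Tra-compatible GS c⁺ preserves) (Sym-compatible GS c⁺) Ctxᶜ (Rfl-compatible GS c⁺)
  where
  GS = G ⊚ Monad.functor S
  c⁺ = determinisation S T G δ σ c
  θ = composeLaw σ (WeakDistributiveLaw.overFunctor δ)
  Ctxᶜ = Ctx-compatible GS c⁺ (WeakDistributiveLawOverFunctor.law θ)
           (extension-isBialgebra θ c)
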